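{- Let $k\in\mathbb N$ with $k\ge 3$ and let $D$ be an oriented graph with minimum pseudo-semidegree $\bar\delta^0(D)\ge (3k-2)/4$. Then $D$ contains each antidirected path of length $k$ (as a subgraph).
   Context: All digraphs are finite. A digraph has directed edges, at most one for each direction between each pair of distinct vertices (no loops); $uv$ denotes an edge from $u$ to $v$. An oriented graph is a digraph in which for each pair of vertices $u,v$ at most one of the edges $uv$, $vu$ is present. $d^-(v)$ and $d^+(v)$ denote the in-degree and out-degree of $v$. The minimum pseudo-semidegree $\bar\delta^0(D)$ of a digraph $D$ is $0$ if $D$ has no edges; otherwise it is the maximum $d\in\mathbb N$ such that each vertex of $D$ has out-degree either $0$ or at least $d$, and in-degree either $0$ or at least $d$ (equivalently, the minimum of all nonzero in-degrees and all nonzero out-degrees of vertices of $D$). An antidirected path (antipath) is an orientation of a path in which every vertex has, within the path, either out-degree $0$ or in-degree $0$; that is, edge directions alternate along the path. Its length is its number of edges. Up to isomorphism there is exactly one antidirected path of length $k$ if $k$ is odd, and there are exactly two if $k$ is even $\ge 2$ (both end-edges directed away from the endvertices, or both directed towards the endvertices); "each antidirected path of length $k$" means all of these. -}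

module Defs where

open import Data.Fin using (Fin; toℕ)
open import Data.Fin.Properties using (all?; any?)
open import Data.List using (filter; length; allFin; upTo)
open import Data.List.Extrema.Nat using (max; argmax-all; xs≤max)
open import Data.List.Membership.Propositional using (lose)
open import Data.List.Membership.Propositional.Properties
  using (∈-allFin; ∈-filter⁺; ∈-upTo⁺)
open import Data.List.Properties using (length-filter; filter-some; length-tabulate)
open import Data.List.Relation.Unary.All as All using ()
open import Data.List.Relation.Unary.All.Properties using (all-filter)
open import Data.Nat using (ℕ; suc; _≤_; z≤n; s≤s; _≟_; _≤?_)
open import Data.Nat.Properties using (≤-trans; ≤-reflexive; >⇒≢)
open import Data.Product using (Σ-syntax; ∃₂; _×_; _,_; proj₁)
open import Data.Sum using (_⊎_; inj₁; inj₂)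
open import Function using (id)
open import Function.Bundles using (_⇔_; _⤖_; module Bijection)
open import Function.Definitions using (Injective)
open import Level using (0ℓ)
open import Relation.Binary.Core using (Rel)
open import Relation.Binary.Definitions using (Decidable; Irreflexive; Asymmetric)
open import Relation.Binary.PropositionalEquality using (_≡_)
open import Relation.Nullary using (Dec; yes; no; contradiction)
open import Relation.Nullary.Decidable using (_×-dec_; _⊎-dec_)

record Digraph : Set₁ where
  field
    order : ℕ

  Vertex : Set
  Vertex = Fin order

  infix 4 _⟶_ _⟶?_
  field
    _⟶_      : Rel Vertex 0ℓ
    _⟶?_     : Decidable _⟶_
    loopless : Irreflexive _≡_ _⟶_

  d⁺ : Vertex → ℕ
  d⁺ v = length (filter (λ u → v ⟶? u) (allFin order))

  d⁻ : Vertex → ℕ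
  d⁻ v = length (filter (λ u → u ⟶? v) (allFin order))

  HasEdge : Set
  HasEdge = ∃₂ λ u v → u ⟶ v

  hasEdge? : Dec HasEdge
  hasEdge? = any? λ u → any? λ v → u ⟶? v

  SemidegreeBound : ℕ → Set
  SemidegreeBound d = ∀ v → (d⁺ v ≡ 0 ⊎ d ≤ d⁺ v) × (d⁻ v ≡ 0 ⊎ d ≤ d⁻ v)

  semidegreeBound? : ∀ d → Dec (SemidegreeBound d)
  semidegreeBound? d = all? λ v →
    (d⁺ v ≟ 0 ⊎-dec d ≤? d⁺ v) ×-dec (d⁻ v ≟ 0 ⊎-dec d ≤? d⁻ v)

  -- Minimum pseudo-semidegree.  If there is an edge, every semidegree bound
  -- is at most the order, so searching 0, …, order finds the maximum; see
  -- δ̄⁰-bound and δ̄⁰-greatest.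
  δ̄⁰ : ℕ
  δ̄⁰ with hasEdge?
  ... | yes _ = max 0 (filter semidegreeBound? (upTo (suc order)))
  ... | no  _ = 0

  δ̄⁰-bound : SemidegreeBound δ̄⁰
  δ̄⁰-bound with hasEdge?
  ... | yes _ = argmax-all id (λ _ → inj₂ z≤n , inj₂ z≤n)
                  (all-filter semidegreeBound? (upTo (suc order)))
  ... | no  _ = λ _ → inj₂ z≤n , inj₂ z≤n

  δ̄⁰-greatest : HasEdge → ∀ d → SemidegreeBound d → d ≤ δ̄⁰
  δ̄⁰-greatest e@(u , v , u⟶v) d bound with hasEdge?
  ... | no ¬e = contradiction e ¬e
  ... | yes _ = All.lookup (xs≤max 0 candidates)
                  (∈-filter⁺ semidegreeBound? (∈-upTo⁺ (s≤s d≤order)) bound)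
    where
    candidates = filter semidegreeBound? (upTo (suc order))

    d⁺≤order : d⁺ u ≤ order
    d⁺≤order = ≤-trans (length-filter (u ⟶?_) (allFin order))
                       (≤-reflexive (length-tabulate {n = order} id))

    d≤order : d ≤ order
    d≤order with proj₁ (bound u)
    ... | inj₂ d≤d⁺ = ≤-trans d≤d⁺ d⁺≤order
    ... | inj₁ d⁺≡0 = contradiction d⁺≡0
                        (>⇒≢ (filter-some (u ⟶?_) (lose (∈-allFin v) u⟶v)))

open Digraph using (Vertex; d⁺; d⁻; δ̄⁰) public

IsOriented : Digraph → Set
IsOriented D = Asymmetric (Digraph._⟶_ D)

Consecutive : ∀ {n} → Rel (Fin n) 0ℓ
Consecutive i j = toℕ j ≡ suc (toℕ i) ⊎ toℕ i ≡ suc (toℕ j)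

record IsAntipath (k : ℕ) (P : Digraph) : Set where
  open Digraph P using (_⟶_)
  field
    oriented     : IsOriented P
    enumeration  : Fin (suc k) ⤖ Vertex P
  open Bijection enumeration using (to)
  field
    path         : ∀ i j → (to i ⟶ to j ⊎ to j ⟶ to i) ⇔ Consecutive i j
    antidirected : ∀ v → d⁺ P v ≡ 0 ⊎ d⁻ P v ≡ 0

-- Containment as a not necessarily induced subgraph.
_Contains_ : Digraph → Digraph → Set
D Contains H = Σ[ f ∈ (Vertex H → Vertex D) ]
  Injective _≡_ _≡_ f × (∀ {u v} → u ⟶ᴴ v → f u ⟶ᴰ f v)
  where
  open Digraph H using () renaming (_⟶_ to _⟶ᴴ_)
  open Digraph D using () renaming (_⟶_ to _⟶ᴰ_)

{-# OPTIONS --safe #-}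

-- Extend antipaths one vertex at a time, at their head, an out-vertex.  Suppose an antipath with
-- set E of out-vertices and set O of in-vertices, |E| + |O| ≤ k, admits no extension, and let T ⊆ E
-- consist of the heads of all antipaths with these out- and in-vertices.  Out-neighbours of t ∈ T
-- lie in E ∪ O.  Pósa rotation gives d⁺_O(t) + |E| ≤ |T| + |O|, and d⁺_E(t) ≤ d⁺_T(t) + |E| - |T|,
-- so d ≤ |O| + d⁺_T(t).  An oriented graph on T has a vertex t with 2 d⁺_T(t) + 1 ≤ |T| ≤ |E|, hence
-- 2d + 1 ≤ |E| + 2|O|.  This is impossible for d ≥ (3k-2)/4 unless |E| = |O| = k/2.  In that case
-- T = E, E induces a regular tournament, and every vertex of E dominates O.  Then a vertex b ∈ E
-- has an in-neighbour y outside E, necessarily outside O as well, and y has an out-neighbour z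
-- outside E; together with an edge t → b inside E they start the antipath
-- z ← y → b ← t → o₁ ← e₁ → o₂ ← ⋯, which has one vertex more.
module Submission where

open import Data.Fin using (Fin; zero; suc; toℕ; inject₁; cast)
open import Data.Fin.Properties
  using (any?; _≟_; sequence; toℕ-inject₁; toℕ-cast; toℕ-injective)
open import Data.Empty using (⊥)
open import Data.List using (List; []; _∷_; _++_; length; filter; allFin; map; lookup)
open import Data.List.Membership.DecPropositional using (_∈?_)
open import Data.List.Membership.Propositional using (_∈_; _∉_; lose)
open import Data.List.Membership.Propositional.Properties
  using (∈-∃++; ∈-filter⁺; ∈-filter⁻; ∈-allFin; ∈-++⁺ʳ; ∈-lookup)
open import Data.List.Properties
  using (filter-++; length-++; length-filter; filter-complete; filter-some; filter-accept; filter-reject)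
open import Data.List.Relation.Binary.Disjoint.Propositional using (Disjoint)
open import Data.List.Relation.Binary.Permutation.Propositional
  using (_↭_; ↭-refl; ↭-sym; ↭-trans; prep; swap; ↭⇒↭ₛ)
open import Data.List.Relation.Binary.Permutation.Propositional.Properties
  using (shift; ∈-resp-↭; ↭-length; filter-↭; ++⁺ˡ; ++⁺ʳ; ++-comm)
open import Data.List.Relation.Binary.Permutation.Setoid.Properties using (Unique-resp-↭)
open import Data.List.Relation.Unary.All as All using (All; []; _∷_)
open import Data.List.Relation.Unary.All.Properties using (¬Any⇒All¬; all-filter)
open import Data.List.Relation.Unary.AllPairs using ([]; _∷_; allPairs?)
open import Data.List.Relation.Unary.Any using (here; there)
open import Data.List.Relation.Unary.Unique.Propositional using (Unique)
open import Data.List.Relation.Unary.Unique.Propositional.Properties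
  using (++⁺; filter⁺; allFin⁺; Unique[x∷xs]⇒x∉xs)
open import Data.Nat using (ℕ; zero; suc; _+_; _*_; _∸_; _≤_; _<_; z≤n; s≤s; z<s; _≤?_)
open import Data.Nat.ListAction using (sum)
open import Data.Nat.Properties hiding (_≟_)
open import Data.Nat.Tactic.RingSolver using (solve-∀)
open import Data.Product using (∃-syntax; _×_; _,_; proj₁; proj₂)
open import Data.Sum as Sum using (_⊎_; inj₁; inj₂)
open import Data.Unit using (⊤; tt)
open import Defs
open import Effect.Monad using (RawMonad)
open import Function using (Equivalence; Inverse; flip; _∘_; id)
open import Function.Definitions using (Injective)
open import Function.Properties.Bijection using (⤖⇒↔)
open import Level using (0ℓ)
open import Relation.Binary.Core using (Rel)
open import Relation.Binary.Definitions using (Asymmetric)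
import Relation.Binary.Definitions as B
open import Relation.Binary.PropositionalEquality
open import Relation.Nullary using (¬_; Dec; yes; no; contradiction)
open import Relation.Nullary.Decidable
  using (_×-dec_; map′; ¬?; ¬¬-excluded-middle; decidable-stable)
open import Relation.Nullary.Negation using (¬¬-Monad)
open import Relation.Unary using (Pred; Decidable)

private variable
  A B : Set
  P Q : Pred A 0ℓ

-- Lists: permutations, pigeonhole, exhaustive search and counting.

Unique-↭ : {xs ys : List A} → xs ↭ ys → Unique xs → Unique ys
Unique-↭ p = Unique-resp-↭ (setoid _) (↭⇒↭ₛ p)

extract : {x : A} {xs : List A} → x ∈ xs → ∃[ ys ] xs ↭ x ∷ ys
extract x∈xs with ys , zs , refl ← ∈-∃++ x∈xs = ys ++ zs , shift _ ys zs

length-⊆ : {xs ys : List A} → Unique xs → (∀ {x} → x ∈ xs → x ∈ ys) → length xs ≤ length ys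
length-⊆ {xs = []} _ _ = z≤n
length-⊆ {xs = x ∷ xs} {ys} u@(_ ∷ uxs) sub with zs , p ← extract (sub (here refl)) =
  subst (suc (length xs) ≤_) (sym (↭-length p)) (s≤s (length-⊆ uxs sub′))
  where
  sub′ : ∀ {y} → y ∈ xs → y ∈ zs
  sub′ y∈xs with ∈-resp-↭ p (sub (there y∈xs))
  ... | here refl = contradiction y∈xs (Unique[x∷xs]⇒x∉xs u)
  ... | there y∈zs = y∈zs

-- Serves a new end `z` of a path that may or may not be an in-vertex already: either way one old
-- entry is given up for it.
replace : ∀ {n} (z : Fin n) (xs : List (Fin n)) → Unique xs → 0 < length xs →
  ∃[ ys ] suc (length ys) ≡ length xs × Unique (z ∷ ys) × (∀ {x} → x ∈ ys → x ∈ xs)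
replace z xs@(x ∷ xs′) u@(_ ∷ u′) _ with _∈?_ _≟_ z xs
... | yes z∈ = let ys , p = extract z∈ in
  ys , sym (↭-length p) , Unique-↭ p u , ∈-resp-↭ (↭-sym p) ∘ there
... | no z∉ = xs′ , refl , ¬Any⇒All¬ _ (z∉ ∘ there) ∷ u′ , there

list? : ∀ {n} {P : Pred (List (Fin n)) 0ℓ} → Decidable P →
        ∀ r → Dec (∃[ xs ] length xs ≡ r × P xs)
list? P? zero = map′ (λ p → [] , refl , p) (λ where ([] , _ , p) → p) (P? [])
list? P? (suc r) =
  map′ (λ (x , xs , e , p) → x ∷ xs , cong suc e , p)
       (λ where (x ∷ xs , e , p) → x , xs , suc-injective e , p)
       (any? λ x → list? (P? ∘ (x ∷_)) r)

count : Decidable {A = A} P → List A → ℕ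
count P? xs = length (filter P? xs)

count-++ : (P? : Decidable P) (xs ys : List A) → count P? (xs ++ ys) ≡ count P? xs + count P? ys
count-++ P? xs ys = trans (cong length (filter-++ P? xs ys)) (length-++ (filter P? xs))

-- Inclusion-exclusion. With `P` adjacency from `t` and `Q` being a head, it limits how many
-- out-neighbours of `t` are lost between `E` and `T`.
count-filter : (P? : Decidable P) (Q? : Decidable Q) (xs : List A) →
  count P? xs + count Q? xs ≤ count P? (filter Q? xs) + length xs
count-filter P? Q? [] = z≤n
count-filter P? Q? (x ∷ xs) with P? x in p | Q? x | count-filter P? Q? xs
... | yes _ | yes _ | ih rewrite p =
  s≤s (≤-trans (≤-reflexive (+-suc _ _)) (≤-trans (s≤s ih) (≤-reflexive (sym (+-suc _ _)))))
... | yes _ | no _ | ih = ≤-trans (s≤s ih) (≤-reflexive (sym (+-suc _ _)))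
... | no _ | yes _ | ih rewrite p =
  ≤-trans (≤-reflexive (+-suc _ _)) (≤-trans (s≤s ih) (≤-reflexive (sym (+-suc _ _))))
... | no _ | no _ | ih = ≤-trans ih (+-monoʳ-≤ _ (n≤1+n _))

count-full : (P? : Decidable P) (xs : List A) → length xs ≤ count P? xs → All P xs
count-full P? xs le =
  subst (All _) (filter-complete P? (≤-antisym (length-filter P? xs) le)) (all-filter P? xs)

count>0 : (P? : Decidable P) (xs : List A) → 0 < count P? xs → ∃[ x ] x ∈ xs × P x
count>0 P? xs pos with filter P? xs in eq
... | y ∷ _ = y , ∈-filter⁻ P? {xs = xs} (subst (y ∈_) (sym eq) (here refl))

module _ {n} {P : Pred (Fin n) 0ℓ} (P? : Decidable P) where

  count-allFin-≤ : ∀ xs → (∀ x → P x → x ∈ xs) → count P? (allFin n) ≤ count P? xs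
  count-allFin-≤ xs sub = length-⊆ (filter⁺ P? (allFin⁺ n)) λ x∈ →
    let px = proj₂ (∈-filter⁻ P? {xs = allFin n} x∈) in ∈-filter⁺ P? (sub _ px) px

  count-allFin->0 : ∀ {x} → P x → 0 < count P? (allFin n)
  count-allFin->0 px = filter-some P? (lose (∈-allFin _) px)

  ∃-outside : ∀ xs → length xs < count P? (allFin n) → ∃[ x ] P x × x ∉ xs
  ∃-outside xs lt with any? (λ x → P? x ×-dec ¬? (_∈?_ _≟_ x xs))
  ... | yes w = w
  ... | no ¬w = contradiction lt (≤⇒≯ (≤-trans (count-allFin-≤ xs λ x px →
          decidable-stable (_∈?_ _≟_ x xs) (λ x∉ → ¬w (x , px , x∉)))
          (length-filter P? xs)))

-- Averaging.

module _ (g : A → ℕ) (c : ℕ) where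

  minimum≤average : ∀ x xs → sum (map g (x ∷ xs)) ≤ length (x ∷ xs) * c → ∃[ y ] y ∈ x ∷ xs × g y ≤ c
  minimum≤average x [] le = x , here refl ,
    subst₂ _≤_ (+-identityʳ (g x)) (+-identityʳ c) le
  minimum≤average x (x′ ∷ xs) le with g x ≤? c
  ... | yes gx≤c = x , here refl , gx≤c
  ... | no gx≰c =
    let y , y∈ , gy≤c = minimum≤average x′ xs
          (+-cancelˡ-≤ c _ _ (≤-trans (+-monoˡ-≤ _ (<⇒≤ (≰⇒> gx≰c))) le))
    in y , there y∈ , gy≤c

  average≤minimum : ∀ {xs} → All (λ x → c ≤ g x) xs → length xs * c ≤ sum (map g xs)
  average≤minimum [] = z≤n
  average≤minimum (c≤ ∷ cs≤) = +-mono-≤ c≤ (average≤minimum cs≤)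

  -- The equality case of averaging: the lower bounds already use up the whole sum.
  constant : ∀ {xs} → All (λ x → c ≤ g x) xs → sum (map g xs) ≤ length xs * c → All (λ x → g x ≤ c) xs
  constant [] _ = []
  constant {x ∷ xs} (c≤ ∷ cs≤) le =
    +-cancelʳ-≤ (length xs * c) (g x) c (≤-trans (+-monoʳ-≤ (g x) (average≤minimum cs≤)) le)
    ∷ constant cs≤ (+-cancelˡ-≤ c _ _ (≤-trans (+-monoˡ-≤ _ c≤) le))

-- Alternating lists, their two vertex classes, and interleaving.

-- x₀ → x₁ ← x₂ → ⋯ in R.
Alt : Rel A 0ℓ → List A → Set
Alt R [] = ⊤
Alt R (_ ∷ []) = ⊤
Alt R (x ∷ y ∷ xs) = R x y × Alt (flip R) (y ∷ xs)

evens odds : List A → List A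
evens [] = []
evens (x ∷ xs) = x ∷ odds xs
odds [] = []
odds (_ ∷ xs) = evens xs

evens++odds : (xs : List A) → evens xs ++ odds xs ↭ xs
evens++odds [] = ↭-refl
evens++odds (x ∷ xs) = prep x (↭-trans (++-comm (odds xs) (evens xs)) (evens++odds xs))

length-evens++odds : (xs : List A) → length (evens xs) + length (odds xs) ≡ length xs
length-evens++odds xs = trans (sym (length-++ (evens xs))) (↭-length (evens++odds xs))

length-evens : (xs : List A) →
  length (evens xs) ≡ length (odds xs) ⊎ length (evens xs) ≡ suc (length (odds xs))
length-evens [] = inj₁ refl
length-evens (x ∷ xs) with length-evens xs
... | inj₁ e = inj₂ (cong suc (sym e))
... | inj₂ e = inj₁ (sym e)

∈-odds : ∀ {x : A} xs → x ∈ odds xs → x ∈ xs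
∈-odds xs = ∈-resp-↭ (evens++odds xs) ∘ ∈-++⁺ʳ (evens xs)

evens-unique : {xs : List A} → Unique xs → Unique (evens xs)
odds-unique : {xs : List A} → Unique xs → Unique (odds xs)
evens-unique [] = []
evens-unique {xs = _ ∷ xs} (x≢ ∷ u) = All.tabulate (All.lookup x≢ ∘ ∈-odds xs) ∷ odds-unique u
odds-unique [] = []
odds-unique (_ ∷ u) = evens-unique u

alt? : {R : Rel A 0ℓ} → B.Decidable R → Decidable (Alt R)
alt? R? [] = yes tt
alt? R? (_ ∷ []) = yes tt
alt? R? (x ∷ y ∷ xs) = R? x y ×-dec alt? (flip R?) (y ∷ xs)

AltPath : ∀ {n} → Rel (Fin n) 0ℓ → ℕ → Set
AltPath R N = ∃[ xs ] length xs ≡ N × Alt R xs × Unique xs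

weave : List A → List A → List A
weave [] ys = ys
weave (x ∷ xs) ys = x ∷ weave ys xs

weave-↭ : (xs ys : List A) → weave xs ys ↭ xs ++ ys
weave-↭ [] ys = ↭-refl
weave-↭ (x ∷ xs) ys = prep x (↭-trans (weave-↭ ys xs) (++-comm ys xs))

module _ {R : Rel A 0ℓ} where

  -- Under complete domination any order within the classes will do; equal lengths keep `weave` from
  -- leaving a tail that lies in one class.
  weave-alt : ∀ {x} xs ys → All (λ y → All (R y) (x ∷ xs)) ys → length xs ≡ length ys →
              Alt (flip R) (x ∷ weave ys xs)
  weave-alt [] [] _ _ = tt
  weave-alt (x′ ∷ xs) (y ∷ ys) ((yx ∷ yx′ ∷ _) ∷ ps) e =
    yx , yx′ , weave-alt xs ys (All.map All.tail ps) (suc-injective e)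

-- The classes are fixed only up to permutation, because rotations reorder a path within them.
Head : Rel A 0ℓ → List A → List A → A → Set
Head R E O x = ∃[ xs ] Alt R (x ∷ xs) × evens (x ∷ xs) ↭ E × odds (x ∷ xs) ↭ O

-- Pósa rotation at the head.

module Rotation {R : Rel A 0ℓ} (R? : B.Decidable R) (t : A) (E O : List A) where

  -- acc is the reversed initial segment, starting at t, of a path that continues with x ∷ rest;
  -- an edge from t to the first vertex of a final segment zs rotates the path.
  record Prefix (x : A) (acc rest : List A) : Set where
    field
      join : ∀ zs → Alt R (t ∷ zs) → Alt R (x ∷ acc ++ zs)
      as bs : List A
      odds-acc : ∀ zs → odds (acc ++ zs) ↭ as ++ odds zs
      evens-acc : ∀ zs → evens (acc ++ zs) ↭ bs ++ evens zs
      E↭ : as ++ x ∷ odds rest ↭ E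
      O↭ : bs ++ evens rest ↭ O

    rotate : Alt R (t ∷ rest) → Head R E O x
    rotate tr = acc ++ rest , join rest tr
           , ↭-trans (prep x (odds-acc rest)) (↭-trans (↭-sym (shift x as (odds rest))) E↭)
           , ↭-trans (evens-acc rest) O↭

  -- `acc` grows by two vertices, so its length stays even and every vertex keeps its class in the
  -- rotated path.
  next : ∀ {x acc w x′ rest} → Alt R (x ∷ w ∷ x′ ∷ rest) →
         Prefix x acc (w ∷ x′ ∷ rest) → Prefix x′ (w ∷ x ∷ acc) rest
  next {x} {acc} {w} {x′} {rest} (xw , x′w , _) p = record
    { join = λ zs tz → x′w , xw , join zs tz
    ; as = x ∷ as
    ; bs = w ∷ bs
    ; odds-acc = λ zs → prep x (odds-acc zs)
    ; evens-acc = λ zs → prep w (evens-acc zs)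
    ; E↭ = ↭-trans (↭-sym (shift x as (x′ ∷ odds rest))) E↭
    ; O↭ = ↭-trans (↭-sym (shift w bs (evens rest))) O↭
    }
    where open Prefix p

  initial : ∀ {xs} → evens (t ∷ xs) ↭ E → odds (t ∷ xs) ↭ O → Prefix t [] xs
  initial e o = record
    { join = λ _ → id ; as = [] ; bs = [] ; odds-acc = λ _ → ↭-refl ; evens-acc = λ _ → ↭-refl
    ; E↭ = e ; O↭ = o }

  module _ (Head? : Decidable (Head R E O)) where

    -- An edge from `t` to an in-vertex `w` makes the out-vertex just before `w` a head. So the
    -- out-vertices that are not heads are at most as many as the in-vertices that `t` misses.
    count-heads : ∀ {x acc} rest → Alt R (x ∷ rest) → Prefix x acc rest →
      count (R? t) (evens rest) + length (x ∷ odds rest)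
        ≤ count Head? (x ∷ odds rest) + length (evens rest)
    -- If the path ends in an out-vertex, reversing all of it makes that vertex a head, with no edge
    -- from `t` required.
    count-heads {x} [] _ p
      rewrite filter-accept Head? {xs = []} (Prefix.rotate p tt) = ≤-refl
    count-heads {x} (w ∷ []) _ p with R? t w
    ... | yes tw rewrite filter-accept Head? {xs = []} (Prefix.rotate p (tw , tt)) = ≤-refl
    ... | no _ = m≤n+m 1 (count Head? (x ∷ []))
    count-heads {x} (w ∷ x′ ∷ rest) a@(xw , x′w , ax) p
      with R? t w | count-heads rest ax (next a p)
    ... | yes tw | ih
      rewrite filter-accept Head? {xs = x′ ∷ odds rest} (Prefix.rotate p (tw , x′w , ax)) =
        s≤s (≤-trans (≤-reflexive (+-suc _ _)) (≤-trans (s≤s ih) (≤-reflexive (sym (+-suc _ _)))))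
    ... | no _ | ih =
      ≤-trans (≤-reflexive (+-suc _ _)) (≤-trans (s≤s ih)
        (≤-trans (≤-reflexive (sym (+-suc _ _))) (+-monoˡ-≤ _ count-tail)))
      where
      count-tail : count Head? (x′ ∷ odds rest) ≤ count Head? (x ∷ x′ ∷ odds rest)
      count-tail with Head? x
      ... | yes _ = n≤1+n _
      ... | no _ = ≤-refl

-- Degree sums in oriented graphs.

module Degrees {R : Rel A 0ℓ} (R? : B.Decidable R) (asym : Asymmetric R) where

  count-out+in : ∀ x xs → count (R? x) xs + count (λ y → R? y x) xs ≤ length xs
  count-out+in x [] = z≤n
  count-out+in x (y ∷ ys) with R? x y | R? y x | count-out+in x ys
  ... | yes xy | yes yx | _ = contradiction yx (asym xy)
  ... | yes _ | no _ | ih = s≤s ih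
  ... | no _ | yes _ | ih = ≤-trans (≤-reflexive (+-suc _ _)) (s≤s ih)
  ... | no _ | no _ | ih = m≤n⇒m≤1+n ih

  -- Normalised so that the weights in a tournament xs sum to exactly |xs|².
  weight : List A → A → ℕ
  weight xs t = suc (2 * count (R? t) xs)

  weight-∷ : ∀ x xs ys → sum (map (weight (x ∷ xs)) ys)
                       ≡ 2 * count (λ y → R? y x) ys + sum (map (weight xs) ys)
  weight-∷ x xs [] = refl
  weight-∷ x xs (y ∷ ys) with R? y x | weight-∷ x xs ys
  ... | yes _ | ih rewrite ih = lemma (count (R? y) xs) (count (λ y → R? y x) ys) _
    where
    lemma : ∀ a b c → suc (2 * suc a) + (2 * b + c) ≡ 2 * suc b + (suc (2 * a) + c)
    lemma = solve-∀
  ... | no _ | ih rewrite ih = lemma (count (R? y) xs) (count (λ y → R? y x) ys) _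
    where
    lemma : ∀ a b c → suc (2 * a) + (2 * b + c) ≡ 2 * b + (suc (2 * a) + c)
    lemma = solve-∀

  -- By asymmetry `x` is joined to `xs` by at most |xs| edges, so peeling it off costs at most 1 +
  -- 2|xs|, the difference of consecutive squares.
  handshake : ∀ xs → sum (map (weight xs) xs) ≤ length xs * length xs
  handshake [] = z≤n
  handshake (x ∷ xs) = begin
    suc (2 * count (R? x) (x ∷ xs)) + sum (map (weight (x ∷ xs)) xs)
      ≡⟨ cong₂ (λ a b → suc (2 * a) + b) (cong length (filter-reject (R? x) (λ xx → asym xx xx)))
               (weight-∷ x xs xs) ⟩
    suc (2 * count (R? x) xs) + (2 * count (λ y → R? y x) xs + sum (map (weight xs) xs))
      ≡⟨ lemma₁ (count (R? x) xs) _ _ ⟩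
    suc (2 * (count (R? x) xs + count (λ y → R? y x) xs)) + sum (map (weight xs) xs)
      ≤⟨ +-mono-≤ (s≤s (*-monoʳ-≤ 2 (count-out+in x xs))) (handshake xs) ⟩
    suc (2 * length xs) + length xs * length xs
      ≡⟨ lemma₂ (length xs) ⟩
    suc (length xs) * suc (length xs) ∎
    where
    open ≤-Reasoning
    lemma₁ : ∀ a b c → suc (2 * a) + (2 * b + c) ≡ suc (2 * (a + b)) + c
    lemma₁ = solve-∀
    lemma₂ : ∀ m → suc (2 * m) + m * m ≡ suc m * suc m
    lemma₂ = solve-∀

-- One half of the pseudo-semidegree condition; `flip R?` gives the other, so reversing all edges
-- just exchanges the two.
MinDegree : ∀ {n} {R : Rel (Fin n) 0ℓ} → B.Decidable R → ℕ → Set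
MinDegree R? d = ∀ v → count (R? v) (allFin _) ≡ 0 ⊎ d ≤ count (R? v) (allFin _)

minDegree-edge : ∀ {n} {R : Rel (Fin n) 0ℓ} (R? : B.Decidable R) {d} → MinDegree R? d →
                 ∀ {u v} → R u v → d ≤ count (R? u) (allFin n)
minDegree-edge R? bound {u} uv with bound u
... | inj₁ e = contradiction e (>⇒≢ (count-allFin->0 (R? u) uv))
... | inj₂ le = le

-- Antipaths that admit no extension at the head.

module Maximal {n} {R : Rel (Fin n) 0ℓ} (R? : B.Decidable R) (asym : Asymmetric R)
  {d : ℕ} (out : MinDegree R? d) (in′ : MinDegree (flip R?) d)
  -- A vertex prepended to a head is an in-vertex, hence `flip R`. Longer paths are excluded on
  -- every vertex set, not only those that extend the given path.
  {N : ℕ} (maximal : ¬ AltPath (flip R) (suc N))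
  (t₀ : Fin n) (p₀ : List (Fin n)) (alt₀ : Alt R (t₀ ∷ p₀))
  (unique₀ : Unique (t₀ ∷ p₀)) (length₀ : length (t₀ ∷ p₀) ≡ N)
  where

  E O : List (Fin n)
  E = evens (t₀ ∷ p₀)
  O = odds (t₀ ∷ p₀)

  uniqueE : Unique E
  uniqueE = evens-unique unique₀

  uniqueO : Unique O
  uniqueO = odds-unique unique₀

  EO↭ : E ++ O ↭ t₀ ∷ p₀
  EO↭ = evens++odds (t₀ ∷ p₀)

  |EO| : length E + length O ≡ N
  |EO| = trans (length-evens++odds (t₀ ∷ p₀)) length₀

  uniqueEO : Unique (E ++ O)
  uniqueEO = Unique-↭ (↭-sym EO↭) unique₀

  H : Pred (Fin n) 0ℓ
  H = Head R E O

  open Degrees R? asym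

  path↭ : ∀ {t} (h : H t) → t ∷ proj₁ h ↭ E ++ O
  path↭ {t} (xs , _ , e , o) = ↭-trans (↭-sym (evens++odds (t ∷ xs)))
    (↭-trans (++⁺ˡ _ o) (++⁺ʳ O e))

  closed : ∀ {t} → H t → ∀ z → R t z → z ∈ E ++ O
  closed {t} h@(xs , alt , _) z tz = decidable-stable (_∈?_ _≟_ z (E ++ O)) λ z∉ → maximal
    ( z ∷ t ∷ xs
    , cong suc (trans (↭-length (path↭ h)) (trans (↭-length EO↭) length₀))
    , (tz , alt)
    , ¬Any⇒All¬ _ (z∉ ∘ ∈-resp-↭ (path↭ h)) ∷ Unique-↭ (↭-sym (path↭ h)) uniqueEO)

  -- As `O` is nonempty, the path has a first edge; it leaves `t`, so the out-degree of `t` is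
  -- nonzero and hence at least `d`.
  degree : ∀ {t} → H t → 0 < length O → d ≤ count (R? t) E + count (R? t) O
  degree ([] , _ , _ , o) pos = contradiction (↭-length o) (<⇒≢ pos)
  degree {t} h@(_ ∷ _ , (ty , _) , _) _ = begin
    d ≤⟨ minDegree-edge R? out ty ⟩
    count (R? t) (allFin n) ≤⟨ count-allFin-≤ (R? t) (E ++ O) (closed h) ⟩
    count (R? t) (E ++ O) ≡⟨ count-++ (R? t) E O ⟩
    count (R? t) E + count (R? t) O ∎
    where open ≤-Reasoning

  head₀ : H t₀
  head₀ = p₀ , alt₀ , ↭-refl , ↭-refl

  module _ (Head? : Decidable H) (pos : 0 < length O) where

    T : List (Fin n)
    T = filter Head? E

    head-degree : ∀ {t} → H t → d ≤ length O + count (R? t) T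
    head-degree {t} h@(xs , alt , e , o) =
      -- Adding |T| + |E| to both sides removes the subtractions from the two estimates.
      +-cancelʳ-≤ (length T + length E) _ _ (begin
        d + (length T + length E)
          ≤⟨ +-monoˡ-≤ _ (degree h pos) ⟩
        count (R? t) E + count (R? t) O + (length T + length E)
          ≡⟨ lemma₁ (count (R? t) E) (count (R? t) O) (length T) (length E) ⟩
        (count (R? t) E + length T) + (count (R? t) O + length E)
          ≤⟨ +-mono-≤ (count-filter (R? t) Head? E) rotated ⟩
        (count (R? t) T + length E) + (length T + length O)
          ≡⟨ lemma₂ (count (R? t) T) (length E) (length T) (length O) ⟩
        length O + count (R? t) T + (length T + length E) ∎)
      where
      open ≤-Reasoning
      open Rotation R? t E O using (initial; count-heads)
      lemma₁ : ∀ a b c e → a + b + (c + e) ≡ (a + c) + (b + e)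
      lemma₁ = solve-∀
      lemma₂ : ∀ a b c e → (a + b) + (c + e) ≡ e + a + (c + b)
      lemma₂ = solve-∀
      rotated : count (R? t) O + length E ≤ length T + length O
      rotated = subst₂ _≤_
        (cong₂ _+_ (↭-length (filter-↭ (R? t) o)) (↭-length e))
        (cong₂ _+_ (↭-length (filter-↭ Head? e)) (↭-length o))
        (count-heads Head? xs alt (initial e o))

    light-head : ∃[ t ] H t × weight T t ≤ length T
    -- `head₀` places `t₀` in `T`, so there is something to average over.
    light-head with T in eq | ∈-filter⁺ Head? {xs = E} (here refl) head₀
    ... | x ∷ xs | _ =
      let t , t∈ , w = minimum≤average (weight (x ∷ xs)) _ x xs (handshake (x ∷ xs))
      in t , proj₂ (∈-filter⁻ Head? {xs = E} (subst (t ∈_) (sym eq) t∈)) , w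

    strict : ¬ (length E + 2 * length O ≤ 2 * d)
    strict le with t , h , w ← light-head = <-irrefl refl (begin-strict
      2 * d ≤⟨ *-monoʳ-≤ 2 (head-degree h) ⟩
      2 * (length O + count (R? t) T) <⟨ ≤-refl ⟩
      suc (2 * (length O + count (R? t) T)) ≡⟨ lemma (length O) _ ⟩
      weight T t + 2 * length O ≤⟨ +-monoˡ-≤ _ (≤-trans w (length-filter Head? E)) ⟩
      length E + 2 * length O ≤⟨ le ⟩
      2 * d ∎)
      where
      open ≤-Reasoning
      lemma : ∀ a b → suc (2 * (a + b)) ≡ suc (2 * b) + 2 * a
      lemma = solve-∀

    -- The tight case of two classes of equal size.

    module Tight (E≡O : length E ≡ length O) (2≤O : 2 ≤ length O)
                 (3O≤ : 3 * length O ≤ suc (2 * d)) where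

      -- Meets the upper bound of `light-head`: as |T| ≤ |E| = |O|, equality is forced throughout.
      heavy : ∀ {t} → H t → length O ≤ weight T t
      heavy {t} h = +-cancelˡ-≤ (2 * length O) _ _ (begin
        2 * length O + length O ≡⟨ lemma₁ (length O) ⟩
        3 * length O ≤⟨ 3O≤ ⟩
        suc (2 * d) ≤⟨ s≤s (*-monoʳ-≤ 2 (head-degree h)) ⟩
        suc (2 * (length O + count (R? t) T)) ≡⟨ lemma₂ (length O) _ ⟩
        2 * length O + weight T t ∎)
        where
        open ≤-Reasoning
        lemma₁ : ∀ a → 2 * a + a ≡ 3 * a
        lemma₁ = solve-∀
        lemma₂ : ∀ a b → suc (2 * (a + b)) ≡ 2 * a + suc (2 * b)
        lemma₂ = solve-∀

      E≤T : length E ≤ length T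
      E≤T with t , h , w ← light-head = begin
        length E ≡⟨ E≡O ⟩
        length O ≤⟨ heavy h ⟩
        weight T t ≤⟨ w ⟩
        length T ∎
        where open ≤-Reasoning

      T≡E : T ≡ E
      T≡E = filter-complete Head? (≤-antisym (length-filter Head? E) E≤T)

      heads : All H E
      heads = count-full Head? E E≤T

      heavyE : All (λ t → length E ≤ weight E t) E
      heavyE = All.map (λ {t} h → ≤-trans (≤-reflexive E≡O)
        (subst (λ S → length O ≤ weight S t) T≡E (heavy h))) heads

      -- The lower bounds in `heavyE` already add up to the |E|² that `handshake` allows.
      regular : All (λ t → weight E t ≤ length E) E
      regular = constant (weight E) (length E) heavyE (handshake E)

      -- Regularity leaves `t` at most (|E| - 1)/2 out-neighbours in `E`, so reaching degree `d`
      -- takes all of `O`.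
      complete : All (λ t → All (R t) O) E
      complete = All.zipWith full (heads , regular)
        where
        open ≤-Reasoning
        lemma₁ : ∀ a → 2 * a + a ≡ 3 * a
        lemma₁ = solve-∀
        lemma₂ : ∀ a b → suc (2 * (a + b)) ≡ 2 * b + suc (2 * a)
        lemma₂ = solve-∀
        full : ∀ {t} → H t × weight E t ≤ length E → All (R t) O
        full {t} (h , w) = count-full (R? t) O (*-cancelˡ-≤ 2 (+-cancelʳ-≤ (length O) _ _ (begin
          2 * length O + length O ≡⟨ lemma₁ (length O) ⟩
          3 * length O ≤⟨ 3O≤ ⟩
          suc (2 * d) ≤⟨ s≤s (*-monoʳ-≤ 2 (degree h pos)) ⟩
          suc (2 * (count (R? t) E + count (R? t) O)) ≡⟨ lemma₂ (count (R? t) E) _ ⟩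
          2 * count (R? t) O + weight E t ≤⟨ +-monoʳ-≤ _ (≤-trans w (≤-reflexive E≡O)) ⟩
          2 * count (R? t) O + length O ∎)))

      -- Since |O| ≥ 2, the bound 2d ≥ 3|O| - 1 exceeds 2|O|. Hence no neighbourhood of size `d`
      -- fits into `E`.
      E<d : length E < d
      E<d = subst (_< d) (sym E≡O) (*-cancelˡ-< 2 _ _ (≤-pred (begin
        2 + 2 * length O ≤⟨ +-monoˡ-≤ (2 * length O) 2≤O ⟩
        3 * length O ≤⟨ 3O≤ ⟩
        suc (2 * d) ∎)))
        where open ≤-Reasoning

      ∈E⇒∉O : ∀ {x} → x ∈ E → x ∉ O
      ∈E⇒∉O x∈E x∈O = asym x→x x→x
        where x→x = All.lookup (All.lookup complete x∈E) x∈O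

      1≤count : 0 < count (R? t₀) E
      1≤count = *-cancelˡ-< 2 _ _ (≤-pred (begin
        2 ≤⟨ 2≤O ⟩
        length O ≡⟨ E≡O ⟨
        length E ≤⟨ All.lookup heavyE (here refl) ⟩
        weight E t₀ ∎))
        where open ≤-Reasoning

      contradictory : ⊥
      contradictory =
        let b , b∈E , t₀b = count>0 (R? t₀) E 1≤count
            -- The edges `t₀b` and `yb` show that the in-degree of `b` and the out-degree of `y` are
            -- nonzero, so both exceed |E|.
            y , yb , y∉E = ∃-outside (flip R? b) E (≤-trans E<d (minDegree-edge (flip R?) in′ t₀b))
            z , yz , z∉E = ∃-outside (R? y) E (≤-trans E<d (minDegree-edge R? out yb))
            Oz , |Oz| , unique-Oz , Oz⊆O = replace z O uniqueO pos
        in longer b∈E t₀b yb y∉E yz z∉E Oz |Oz| unique-Oz Oz⊆O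
        where
        longer : ∀ {b y z} → b ∈ E → R t₀ b → R y b → y ∉ E → R y z → z ∉ E →
                 ∀ Oz → suc (length Oz) ≡ length O → Unique (z ∷ Oz) → (∀ {x} → x ∈ Oz → x ∈ O) → ⊥
        longer b∈E t₀b yb y∉E yz z∉E [] |Oz| _ _ =
          contradiction (subst (2 ≤_) (sym |Oz|) 2≤O) λ where (s≤s ())
        longer (here refl) t₀t₀ _ _ _ _ (_ ∷ _) _ _ _ = asym t₀t₀ t₀t₀
        longer {b} {y} {z} b∈E@(there b∈) t₀b yb y∉E yz z∉E (o ∷ Oz) |Oz| unique-Oz Oz⊆O =
          let Eb , odds↭ = extract b∈
              E↭ : E ↭ t₀ ∷ b ∷ Eb
              E↭ = prep t₀ odds↭
              E⊇ : ∀ {x} → x ∈ t₀ ∷ b ∷ Eb → x ∈ E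
              E⊇ = ∈-resp-↭ (↭-sym E↭)
              -- `b` dominates `O`, so no in-neighbour of `b` lies there.
              y∉O = λ y∈O → asym yb (All.lookup (All.lookup complete b∈E) y∈O)
              disjoint : Disjoint (z ∷ o ∷ Oz) (y ∷ t₀ ∷ b ∷ Eb)
              disjoint = λ where
                (here refl , here refl) → asym yz yz
                (here refl , there x∈E) → z∉E (E⊇ x∈E)
                (there x∈O , here refl) → y∉O (Oz⊆O x∈O)
                (there x∈O , there x∈E) → ∈E⇒∉O (E⊇ x∈E) (Oz⊆O x∈O)
              unique-yE : Unique (y ∷ t₀ ∷ b ∷ Eb)
              unique-yE = ¬Any⇒All¬ _ (y∉E ∘ E⊇) ∷ Unique-↭ E↭ uniqueE
              path↭ : (z ∷ o ∷ Oz) ++ (y ∷ t₀ ∷ b ∷ Eb) ↭ z ∷ y ∷ b ∷ t₀ ∷ weave (o ∷ Oz) Eb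
              path↭ = prep z (↭-trans (++-comm (o ∷ Oz) (y ∷ t₀ ∷ b ∷ Eb)) (prep y (swap t₀ b
                (↭-trans (++-comm Eb (o ∷ Oz)) (↭-sym (weave-↭ (o ∷ Oz) Eb))))))
              edges : All (λ e → All (R e) (o ∷ Oz)) Eb
              edges = All.tabulate λ e∈ → All.tabulate λ x∈ →
                All.lookup (All.lookup complete (E⊇ (there (there e∈)))) (Oz⊆O x∈)
              t₀o = All.lookup (All.head complete) (Oz⊆O (here refl))
          in maximal
            ( z ∷ y ∷ b ∷ t₀ ∷ weave (o ∷ Oz) Eb
            , (begin
                length (z ∷ y ∷ b ∷ t₀ ∷ weave (o ∷ Oz) Eb)
                  ≡⟨ ↭-length path↭ ⟨
                length ((z ∷ o ∷ Oz) ++ (y ∷ t₀ ∷ b ∷ Eb))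
                  ≡⟨ length-++ (z ∷ o ∷ Oz) ⟩
                length (z ∷ o ∷ Oz) + suc (length (t₀ ∷ b ∷ Eb))
                  ≡⟨ cong₂ (λ i j → i + suc j) |Oz| (sym (↭-length E↭)) ⟩
                length O + suc (length E)
                  ≡⟨ +-suc (length O) (length E) ⟩
                suc (length O + length E)
                  ≡⟨ cong suc (trans (+-comm (length O) (length E)) |EO|) ⟩
                suc N ∎)
            -- After `o`, both classes have |O| - 2 vertices left: one has given up a vertex for `z`
            -- and then `o`, the other `t₀` and `b`.
            , (yz , yb , t₀b , t₀o , weave-alt Oz Eb edges
                (suc-injective (suc-injective (trans |Oz| (trans (sym E≡O) (↭-length E↭))))))
            , Unique-↭ path↭ (++⁺ unique-Oz unique-yE disjoint))
          where open ≡-Reasoning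

-- Arithmetic of the degree bound.

module _ (k d e o : ℕ) (bound : 3 * k ≤ 2 + 4 * d) (e+o≤k : e + o ≤ k) where

  open ≤-Reasoning

  3[e+o]≤ : 3 * (e + o) ≤ 2 + 4 * d
  3[e+o]≤ = ≤-trans (*-monoʳ-≤ 3 e+o≤k) bound

  -- The bound gives only 6o + 1 ≤ 4d; parity supplies the missing unit.
  odd-order : e ≡ suc o → e + 2 * o ≤ 2 * d
  odd-order refl with 1 + o + 2 * o ≤? 2 * d
  ... | yes le = le
  ... | no ≰ = contradiction (begin
    3 + 2 * (3 * o) ≡⟨ lemma₁ o ⟩
    3 * (1 + o + o) ≤⟨ 3[e+o]≤ ⟩
    2 + 4 * d ≡⟨ lemma₂ d ⟩
    2 + 2 * (2 * d) ≤⟨ +-monoʳ-≤ 2 (*-monoʳ-≤ 2 (≤-pred (≰⇒> ≰))) ⟩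
    2 + 2 * (3 * o) ∎) (<⇒≱ (n<1+n _))
    where
    lemma₁ : ∀ o → 3 + 2 * (3 * o) ≡ 3 * (1 + o + o)
    lemma₁ = solve-∀
    lemma₂ : ∀ d → 2 + 4 * d ≡ 2 + 2 * (2 * d)
    lemma₂ = solve-∀

  even-order : e ≡ o → 3 * o ≤ suc (2 * d)
  even-order refl = *-cancelˡ-≤ 2 (begin
    2 * (3 * o) ≡⟨ lemma₁ o ⟩
    3 * (o + o) ≤⟨ 3[e+o]≤ ⟩
    2 + 4 * d ≡⟨ lemma₂ d ⟩
    2 * suc (2 * d) ∎)
    where
    lemma₁ : ∀ o → 2 * (3 * o) ≡ 3 * (o + o)
    lemma₁ = solve-∀
    lemma₂ : ∀ d → 2 + 4 * d ≡ 2 * suc (2 * d)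
    lemma₂ = solve-∀

  -- With 2d < 3o the bound yields k ≤ 2o, so k ≥ 3 excludes o ≤ 1.
  tight-order : 3 ≤ k → 2 * d < 3 * o → 2 ≤ o
  tight-order 3≤k lt = *-cancelˡ-< 2 _ _ (≤-trans 3≤k (*-cancelˡ-≤ 3 (begin
    3 * k ≤⟨ bound ⟩
    2 + 4 * d ≡⟨ lemma₂ d ⟩
    2 * suc (2 * d) ≤⟨ *-monoʳ-≤ 2 lt ⟩
    2 * (3 * o) ≡⟨ lemma₁ o ⟩
    3 * (2 * o) ∎)))
    where
    lemma₁ : ∀ o → 2 * (3 * o) ≡ 3 * (2 * o)
    lemma₁ = solve-∀
    lemma₂ : ∀ d → 2 + 4 * d ≡ 2 * suc (2 * d)
    lemma₂ = solve-∀

-- Growing an antipath vertex by vertex.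

extend : ∀ {n} {R : Rel (Fin n) 0ℓ} (R? : B.Decidable R) → Asymmetric R →
  ∀ {d} → MinDegree R? d → MinDegree (flip R?) d →
  ∀ {k} → 3 ≤ k → 3 * k ≤ 2 + 4 * d →
  ∀ {N} → 2 ≤ N → N ≤ k → AltPath R N → AltPath (flip R) (suc N)
extend _ _ _ _ _ _ () _ ([] , refl , _)
extend {n} {R} R? asym {d} out in′ {k} 3≤k bound {N} 2≤N N≤k (t₀ ∷ p₀ , len , alt , unique) =
  -- The goal is decidable, so its failure may be assumed. For the refutation, `Decidable H` under a
  -- double negation suffices, which finitely many instances of excluded middle provide.
  decidable-stable (list? (λ xs → alt? (flip R?) xs ×-dec allPairs? (λ x y → ¬? (x ≟ y)) xs) (suc N))
    λ maximal → sequence (RawMonad.rawApplicative ¬¬-Monad) (λ _ → ¬¬-excluded-middle) (absurd maximal)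
  where
  module _ (maximal : ¬ AltPath (flip R) (suc N)) where
    open Maximal R? asym out in′ maximal t₀ p₀ alt unique len

    e+o≤k : length E + length O ≤ k
    e+o≤k = subst (_≤ k) (sym |EO|) N≤k

    pos : ∀ p → 2 ≤ suc (length p) → 0 < length (evens p)
    pos [] (s≤s ())
    pos (_ ∷ _) _ = z<s

    absurd : ¬ Decidable H
    absurd Head? with length-evens (t₀ ∷ p₀) | pos p₀ (subst (2 ≤_) (sym len) 2≤N)
    ... | inj₂ E≡1+O | 0<O = strict Head? 0<O (odd-order k d (length E) (length O) bound e+o≤k E≡1+O)
    ... | inj₁ E≡O | 0<O with 3 * length O ≤? 2 * d
    ...   | yes le = strict Head? 0<O (subst (λ e → e + 2 * length O ≤ 2 * d) (sym E≡O) le)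
    ...   | no ≰ = Tight.contradictory Head? 0<O E≡O
      (tight-order k d (length E) (length O) bound e+o≤k 3≤k (≰⇒> ≰))
      (even-order k d (length E) (length O) bound e+o≤k E≡O)

-- Each extension changes the class of the first vertex, so the induction switches between `R` and
-- `flip R` and has to quantify over the relation.
alternating : ∀ {d k} → 3 ≤ k → 3 * k ≤ 2 + 4 * d →
  ∀ m → 2 + m ≤ suc k →
  ∀ {n} {R : Rel (Fin n) 0ℓ} (R? : B.Decidable R) → Asymmetric R →
  MinDegree R? d → MinDegree (flip R?) d →
  ∀ {u v} → R u v → AltPath R (2 + m)
alternating _ _ zero _ _ asym _ _ {u} {v} uv =
  u ∷ v ∷ [] , refl , (uv , tt) , ((λ where refl → asym uv uv) ∷ []) ∷ [] ∷ []
alternating 3≤k bound (suc m) m<k R? asym out in′ uv =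
  extend (flip R?) (flip asym) in′ out 3≤k bound (s≤s (s≤s z≤n)) (≤-pred m<k)
    (alternating 3≤k bound m (<⇒≤ m<k) (flip R?) (flip asym) in′ out uv)

-- Mapping an antipath onto an alternating list.

lookup-injective : {xs : List A} → Unique xs → Injective _≡_ _≡_ (lookup xs)
lookup-injective {xs = _ ∷ _} _ {zero} {zero} _ = refl
lookup-injective {xs = _ ∷ _} (x≢ ∷ _) {zero} {suc j} e = contradiction e (All.lookup x≢ (∈-lookup j))
lookup-injective {xs = _ ∷ _} (x≢ ∷ _) {suc i} {zero} e = contradiction (sym e) (All.lookup x≢ (∈-lookup i))
lookup-injective {xs = _ ∷ _} (_ ∷ u) {suc i} {suc j} e = cong suc (lookup-injective u e)

-- Alternation by position: the parity of the index decides the direction.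
Edge : ℕ → Rel A 0ℓ → Rel A 0ℓ
Edge zero R = R
Edge (suc i) R = Edge i (flip R)

lookup-edge : {R : Rel A 0ℓ} (xs : List A) → Alt R xs → ∀ i j → toℕ j ≡ suc (toℕ i) →
              Edge (toℕ i) R (lookup xs i) (lookup xs j)
lookup-edge (x ∷ y ∷ xs) (xy , _) zero (suc zero) _ = xy
lookup-edge (x ∷ y ∷ xs) (_ , a) (suc i) (suc j) e = lookup-edge (y ∷ xs) a i j (suc-injective e)

-- Two successive edges in the same direction would give their common vertex both an in-edge and an
-- out-edge.
edge-next : {S : Rel A 0ℓ} → (∀ {u v w} → S u v → ¬ S v w) →
  ∀ i {u v w} → Edge i S u v → S v w ⊎ S w v → Edge (suc i) S v w
edge-next anti zero uv (inj₁ vw) = contradiction vw (anti uv)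
edge-next anti zero uv (inj₂ wv) = wv
edge-next anti (suc i) uv vw = edge-next (λ vu wv → anti wv vu) i uv (Sum.swap vw)

transfer : ∀ i {R : Rel A 0ℓ} {S : Rel B 0ℓ} → Asymmetric S → ∀ {u v x y} →
  Edge i S u v → Edge i R x y → (S u v → R x y) × (S v u → R y x)
transfer zero asym uv xy = (λ _ → xy) , λ vu → contradiction vu (asym uv)
transfer (suc i) asym uv xy = let f , g = transfer i (flip asym) uv xy in g , f

module _ {m n} {V : Set} {S : Rel V 0ℓ} {R : Rel (Fin n) 0ℓ} (asym : Asymmetric S)
  (anti : ∀ {u v w} → S u v → ¬ S v w)
  (to : Fin (suc (suc m)) → V) (from : V → Fin (suc (suc m))) (to-from : ∀ v → to (from v) ≡ v)
  (path→ : ∀ {i j} → S (to i) (to j) → Consecutive i j)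
  (path← : ∀ {i j} → Consecutive i j → S (to i) (to j) ⊎ S (to j) (to i))
  where

  -- The first edge determines all others. The position `a` is a separate argument so that the
  -- recursion can step from `suc i` to `inject₁ i`.
  path-edge : S (to zero) (to (suc zero)) → ∀ a i j → toℕ i ≡ a → toℕ j ≡ suc a → Edge a S (to i) (to j)
  path-edge s zero zero (suc zero) _ _ = s
  path-edge s (suc a) (suc i) j refl ej =
    edge-next anti a (path-edge s a (inject₁ i) (suc i) (toℕ-inject₁ i) refl) (path← (inj₁ ej))

  embed : S (to zero) (to (suc zero)) → AltPath R (suc (suc m)) →
    ∃[ f ] Injective _≡_ _≡_ f × (∀ {u v} → S u v → R (f u) (f v))
  embed s (xs , len , alt , unique) = f , injective , preserves
    where
    ι : Fin (suc (suc m)) → Fin (length xs)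
    ι = cast (sym len)

    f : V → Fin n
    f v = lookup xs (ι (from v))

    injective : Injective _≡_ _≡_ f
    injective {u} {v} e = begin
      u ≡⟨ to-from u ⟨
      to (from u) ≡⟨ cong to (cast-injective (lookup-injective unique e)) ⟩
      to (from v) ≡⟨ to-from v ⟩
      v ∎
      where
      open ≡-Reasoning
      cast-injective : ∀ {i j} → ι i ≡ ι j → i ≡ j
      cast-injective {i} {j} e = toℕ-injective
        (trans (sym (toℕ-cast (sym len) i)) (trans (cong toℕ e) (toℕ-cast (sym len) j)))

    edge : ∀ i j → toℕ j ≡ suc (toℕ i) → Edge (toℕ i) R (lookup xs (ι i)) (lookup xs (ι j))
    edge i j e = subst (λ a → Edge a R (lookup xs (ι i)) (lookup xs (ι j))) (toℕ-cast (sym len) i)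
      (lookup-edge xs alt (ι i) (ι j) (trans (toℕ-cast (sym len) j)
        (trans e (cong suc (sym (toℕ-cast (sym len) i))))))

    step : ∀ i j → S (to i) (to j) → R (lookup xs (ι i)) (lookup xs (ι j))
    step i j ij with path→ ij
    ... | inj₁ e = proj₁ (transfer (toℕ i) asym (path-edge s _ i j refl e) (edge i j e)) ij
    ... | inj₂ e = proj₂ (transfer (toℕ j) asym (path-edge s _ j i refl e) (edge j i e)) ij

    preserves : ∀ {u v} → S u v → R (f u) (f v)
    preserves {u} {v} uv = step (from u) (from v) (subst₂ S (sym (to-from u)) (sym (to-from v)) uv)

δ̄⁰>0⇒edge : (D : Digraph) → 0 < δ̄⁰ D → Digraph.HasEdge D
δ̄⁰>0⇒edge D pos with Digraph.hasEdge? D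
... | yes e = e

theorem2 : (k : ℕ) → 3 ≤ k →
    (D : Digraph) → IsOriented D →
    3 * k ∸ 2 ≤ 4 * δ̄⁰ D →
    (P : Digraph) → IsAntipath k P → D Contains P
theorem2 k@(suc m) 3≤k D asym bound P isAntipath =
  result (Equivalence.from (path zero (suc zero)) (inj₁ refl))
  where
  open Digraph D using (_⟶_; _⟶?_)
  open Digraph P using () renaming (_⟶_ to _⟶ᴾ_; _⟶?_ to _⟶ᴾ?_)
  open IsAntipath isAntipath

  to : Fin (suc k) → Vertex P
  to = Inverse.to (⤖⇒↔ enumeration)

  from : Vertex P → Fin (suc k)
  from = Inverse.from (⤖⇒↔ enumeration)

  to-from : ∀ v → to (from v) ≡ v
  to-from = Inverse.strictlyInverseˡ (⤖⇒↔ enumeration)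

  anti : ∀ {u v w} → u ⟶ᴾ v → ¬ (v ⟶ᴾ w)
  anti {u} {v} uv vw with antidirected v
  ... | inj₁ e = contradiction e (>⇒≢ (count-allFin->0 (v ⟶ᴾ?_) vw))
  ... | inj₂ e = contradiction e (>⇒≢ (count-allFin->0 (_⟶ᴾ? v) uv))

  bound′ : 3 * k ≤ 2 + 4 * δ̄⁰ D
  bound′ = ≤-trans (m≤n+m∸n (3 * k) 2) (+-monoʳ-≤ 2 bound)

  -- As 3k > 2, the bound is nonzero, so `D` has an edge from which to start.
  positive : 0 < δ̄⁰ D
  positive = *-cancelˡ-< 4 0 _ (≤-trans (m<n⇒0<n∸m (≤-trans 3≤k (m≤n*m k 3))) bound)

  out : MinDegree _⟶?_ (δ̄⁰ D)
  out v = proj₁ (Digraph.δ̄⁰-bound D v)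

  in′ : MinDegree (flip _⟶?_) (δ̄⁰ D)
  in′ v = proj₂ (Digraph.δ̄⁰-bound D v)

  result : to zero ⟶ᴾ to (suc zero) ⊎ to (suc zero) ⟶ᴾ to zero → D Contains P
  result (inj₁ s) =
    embed oriented anti to from to-from
      (λ ij → Equivalence.to (path _ _) (inj₁ ij)) (Equivalence.from (path _ _)) s
      -- As k = m + 1, the list has 2 + m = k + 1 vertices.
      (alternating 3≤k bound′ m ≤-refl _⟶?_ asym out in′ (proj₂ (proj₂ (δ̄⁰>0⇒edge D positive))))
  -- Reversing all edges of both `P` and `D` reduces a backward first edge to a forward one.
  result (inj₂ s) =
    let f , injective , preserves =
          embed {S = flip _⟶ᴾ_} {R = flip _⟶_} (flip oriented) (λ vu wv → anti wv vu) to from to-from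
            (λ ij → Equivalence.to (path _ _) (inj₂ ij)) (Sum.swap ∘ Equivalence.from (path _ _)) s
            (alternating 3≤k bound′ m ≤-refl (flip _⟶?_) (flip asym) in′ out
              (proj₂ (proj₂ (δ̄⁰>0⇒edge D positive))))
    in f , injective , λ uv → preserves uv
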